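{- Let $\frac14(1+\sqrt2)\le\sigma\le1$. For all positive integers $n$, a red-blue copy of $K_n$ with $\sigma\binom n2$ red edges has at most $\frac12\sigma^3(1-\sigma)n^4+O(n^3)$ $RRRB$-cycles. Furthermore, for all $0<\delta<10^{ -6}$ there exists $n_0$ such that whenever $n\ge n_0$ and $G$ is a red-blue copy of $K_n$ with $\sigma\binom n2$ red edges and more than $\frac12\sigma^3(1-\sigma)n^4-\delta n^4$ $RRRB$-cycles, the red graph $R$ of $G$ is $(4\delta^{1/8})$-quasirandom of density $\sigma$.
   Context: A red-blue $K_n$ is a complete graph on $n$ vertices each of whose edges is coloured red or blue; its red graph $R$ consists of the red edges. An $RRRB$-cycle is a $4$-cycle (counted as a subgraph) with exactly three red edges and one blue edge. For $\varepsilon>0$, an $n$-vertex graph $J$ of density $\sigma=e(J)/\binom n2$ is $\varepsilon$-quasirandom if $\sum_{x\neq y}\left||N_J(x)\cap N_J(y)|-\sigma^2n\right|<\varepsilon n^3$ (sum over ordered pairs of distinct vertices).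
   Formalization: The parameters δ and σ are taken rational instead of real (for σ this loses nothing, since σ·C(n,2) being an edge count forces rationality for n ≥ 2); the bound 4δ^{1/8} is expressed through all rational ε ≥ 0 with ε^8 ≥ 4^8·δ. -}

module Defs where

open import Data.Bool using (Bool; true; false; if_then_else_; _∧_; not)
open import Data.Nat as ℕ using (ℕ; zero; suc)
open import Data.Nat.Combinatorics using (_C_)
open import Data.Fin using (Fin; zero; suc; toℕ)
import Data.Fin as Fin
open import Data.Integer using (+_)
open import Data.Rational using (ℚ; _+_; _*_; _-_; _/_; ∣_∣; 0ℚ; 1ℚ)
open import Relation.Nullary using (does)
open import Relation.Binary.PropositionalEquality using (_≡_)

ℕ→ℚ : ℕ → ℚ
ℕ→ℚ k = + k / 1

_^ℚ_ : ℚ → ℕ → ℚ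
q ^ℚ zero  = 1ℚ
q ^ℚ suc k = q * (q ^ℚ k)

sumℕ : (n : ℕ) → (Fin n → ℕ) → ℕ
sumℕ zero    f = 0
sumℕ (suc n) f = f zero ℕ.+ sumℕ n (λ i → f (suc i))

sumℚ : (n : ℕ) → (Fin n → ℚ) → ℚ
sumℚ zero    f = 0ℚ
sumℚ (suc n) f = f zero + sumℚ n (λ i → f (suc i))

b2n : Bool → ℕ
b2n true  = 1
b2n false = 0

_≠ᵇ_ : {n : ℕ} → Fin n → Fin n → Bool
i ≠ᵇ j = not (does (i Fin.≟ j))

-- A red-blue K_n: colour c x y (true = red, false = blue) of the edge xy,
-- required to be symmetric; the diagonal values are irrelevant.
record RedBlueK (n : ℕ) : Set where
  field
    colour : Fin n → Fin n → Bool
    symm   : ∀ x y → colour x y ≡ colour y x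
open RedBlueK public

redEdges : {n : ℕ} → RedBlueK n → ℕ
redEdges {n} G = sumℕ n λ x → sumℕ n λ y →
  b2n (does (toℕ x ℕ.<? toℕ y) ∧ colour G x y)

orderedRRRB : {n : ℕ} → RedBlueK n → ℕ
orderedRRRB {n} G =
  sumℕ n λ a → sumℕ n λ b → sumℕ n λ c → sumℕ n λ d →
    b2n ((a ≠ᵇ b) ∧ (a ≠ᵇ c) ∧ (a ≠ᵇ d) ∧ (b ≠ᵇ c) ∧ (b ≠ᵇ d) ∧ (c ≠ᵇ d)
         ∧ does ((b2n (colour G a b) ℕ.+ b2n (colour G b c)
                  ℕ.+ b2n (colour G c d) ℕ.+ b2n (colour G d a)) ℕ.≟ 3))

-- number of RRRB-cycles counted as subgraphs: each 4-cycle corresponds to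
-- exactly 8 ordered tuples (4 starting points × 2 directions)
rrrbCycles : {n : ℕ} → RedBlueK n → ℕ
rrrbCycles G = orderedRRRB G ℕ./ 8

HasRedDensity : {n : ℕ} → RedBlueK n → ℚ → Set
HasRedDensity {n} G σ = ℕ→ℚ (redEdges G) ≡ σ * ℕ→ℚ (n C 2)

codeg : {n : ℕ} → RedBlueK n → Fin n → Fin n → ℕ
codeg {n} G x y = sumℕ n λ z →
  b2n ((z ≠ᵇ x) ∧ (z ≠ᵇ y) ∧ colour G x z ∧ colour G y z)

RedQuasirandom : {n : ℕ} → RedBlueK n → ℚ → ℚ → Set
RedQuasirandom {n} G σ ε =
  sumℚ n (λ x → sumℚ n λ y →
    if x ≠ᵇ y then ∣ ℕ→ℚ (codeg G x y) - σ * σ * ℕ→ℚ n ∣ else 0ℚ)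
  Data.Rational.< ε * (ℕ→ℚ n ^ℚ 3)

{-# OPTIONS --safe #-}
module Submission where

-- Let A be the red adjacency matrix, d the degrees, c(x,y) the codegrees, N = n and p = σ. There are ½ Σ A_ab A_bc A_cd A'_da
-- RRRB-cycles, A' being the blue adjacency matrix, so at most ½ (W − Q) with W = Σ c(x,y) d(y) and Q = Σ c(x,y)². Completing the
-- square in c(x,y) gives, up to O(N³), W − Q = p³(1 − p) N⁴ − (2p² − p − 1/8) N Σ (d(x) − pN)² − Z, where Z is the sum of the
-- squares of the residuals c(x,y) − (d(x) + d(y))/4 − (p² − p/2) N; the middle coefficient is nonnegative iff (4p − 1)² ≥ 2.
-- For stability, many RRRB-cycles force Z = O(δ N⁴). At the threshold value of p nothing is learnt directly about the degrees,
-- but the sum of the residuals is Σ (d(x) − pN)² up to O(N²), so by Cauchy–Schwarz the degree variance is small as well.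
-- Both together bound Σ (c(x,y) − p²N)².

open import Defs
open import Data.Bool using (Bool; true; false; if_then_else_; _∧_)
open import Data.Bool.Properties using (∧-zeroʳ)
open import Data.Fin as Fin using (Fin; zero; suc; toℕ)
import Data.Fin.Properties as Fin
open import Data.Integer as ℤ using (+_)
import Data.Integer.Properties as ℤ
open import Data.List using (List; []; _∷_)
open import Data.Nat as ℕ using (ℕ; zero; suc; _≥_)
open import Data.Nat.Combinatorics using (_C_; nC1≡n; nCk+nC[k+1]≡[n+1]C[k+1])
open import Data.Nat.DivMod using (m/n*n≤m)
import Data.Nat.Properties as ℕ
open import Data.Product using (_×_; _,_; ∃; ∃-syntax)
open import Data.Rational using (ℚ; _+_; _*_; _-_; -_; _/_; _≤_; _<_; 0ℚ; 1ℚ; ½; ∣_∣; mkℚ; *<*; ↧ₙ_; positive; nonNegative; toℚᵘ)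
open import Data.Rational.Properties
open import Data.Rational.Solver using (module +-*-Solver)
import Data.Rational.Unnormalised as ℚᵘ
import Data.Rational.Unnormalised.Properties as ℚᵘ
open import Data.Sum using (inj₁; inj₂)
open import Function using (_∘_)
open import Relation.Binary using (tri<; tri≈; tri>)
open import Relation.Binary.PropositionalEquality
open import Relation.Nullary using (¬_; Dec; yes; no; does; contradiction)
open import Relation.Nullary.Decidable using (from-yes; from-no; map′; _×-dec_; dec-true; dec-false)
open +-*-Solver using (Polynomial; solve; con; _:=_; _:+_; _:*_; _:-_; :-_)

-- Ordered-field arithmetic

4ℚ 2ℚ ⅛ ¼ : ℚ
4ℚ = + 4 / 1
2ℚ = + 2 / 1
⅛ = + 1 / 8
¼ = + 1 / 4

+-congˡ : ∀ p {q r} → q ≡ r → p + q ≡ p + r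
+-congˡ p = cong (λ q → p + q)

+-nonneg : ∀ {p q} → 0ℚ ≤ p → 0ℚ ≤ q → 0ℚ ≤ p + q
+-nonneg = +-mono-≤

*-monoˡ-≤ : ∀ {p q r} → 0ℚ ≤ r → p ≤ q → r * p ≤ r * q
*-monoˡ-≤ {r = r} 0≤r = *-monoˡ-≤-nonNeg r {{nonNegative 0≤r}}

*-nonneg : ∀ {p q} → 0ℚ ≤ p → 0ℚ ≤ q → 0ℚ ≤ p * q
*-nonneg {p} {q} 0≤p 0≤q = subst (_≤ p * q) (*-zeroʳ p) (*-monoˡ-≤ 0≤p 0≤q)

*-mono-≤ : ∀ {p q r s} → 0ℚ ≤ p → 0ℚ ≤ s → p ≤ q → r ≤ s → p * r ≤ q * s
*-mono-≤ {p} {q} {r} {s} 0≤p 0≤s p≤q r≤s =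
  ≤-trans (*-monoˡ-≤ 0≤p r≤s) (*-monoʳ-≤-nonNeg s {{nonNegative 0≤s}} p≤q)

*-pos : ∀ {p q} → 0ℚ < p → 0ℚ < q → 0ℚ < p * q
*-pos {p} {q} 0<p 0<q = subst (_< p * q) (*-zeroʳ p) (*-monoʳ-<-pos p {{positive 0<p}} 0<q)

*-cancelˡ-≤ : ∀ {p q r} → 0ℚ < r → r * p ≤ r * q → p ≤ q
*-cancelˡ-≤ {r = r} 0<r = *-cancelˡ-≤-pos r {{positive 0<r}}

p*p≡∣p∣*∣p∣ : ∀ p → p * p ≡ ∣ p ∣ * ∣ p ∣
p*p≡∣p∣*∣p∣ p with ∣p∣≡p∨∣p∣≡-p p
... | inj₁ eq = sym (cong₂ _*_ eq eq)
... | inj₂ eq = trans (solve 1 (λ x → x :* x := (:- x) :* (:- x)) refl p) (sym (cong₂ _*_ eq eq))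

square-nonneg : ∀ p → 0ℚ ≤ p * p
square-nonneg p = subst (0ℚ ≤_) (sym (p*p≡∣p∣*∣p∣ p)) (*-nonneg (0≤∣p∣ p) (0≤∣p∣ p))

p≤q⇒0≤q-p : ∀ {p q} → p ≤ q → 0ℚ ≤ q - p
p≤q⇒0≤q-p {p} {q} p≤q = subst (_≤ q - p) (+-inverseʳ p) (+-monoˡ-≤ (- p) p≤q)

0≤q-p⇒p≤q : ∀ {p q} → 0ℚ ≤ q - p → p ≤ q
0≤q-p⇒p≤q {p} {q} 0≤q-p =
  subst₂ _≤_ (+-identityʳ p) (solve 2 (λ p q → p :+ (q :- p) := q) refl p q) (+-monoʳ-≤ p 0≤q-p)

-- The polynomial inequalities below are certified this way: the ring solver checks that the
-- difference equals `r`, a sum of visibly nonnegative terms.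
≤-by-difference : ∀ {p q r} → q - p ≡ r → 0ℚ ≤ r → p ≤ q
≤-by-difference q-p≡r 0≤r = 0≤q-p⇒p≤q (subst (0ℚ ≤_) (sym q-p≡r) 0≤r)

-- Positive linear functionals

-- Sums over vertices, pairs and quadruples are all instances, so term-by-term expansion and
-- Cauchy-Schwarz are proved once.
record Positive-Linear {I : Set} (L : (I → ℚ) → ℚ) : Set where
  field
    L-cong : ∀ {f g} → (∀ i → f i ≡ g i) → L f ≡ L g
    L-+    : ∀ f g → L (λ i → f i + g i) ≡ L f + L g
    L-*    : ∀ a f → L (λ i → a * f i) ≡ a * L f
    L-mono : ∀ {f g} → (∀ i → f i ≤ g i) → L f ≤ L g

  L-*ʳ : ∀ a f → L (λ i → f i * a) ≡ L f * a
  L-*ʳ a f = trans (L-cong (λ i → *-comm (f i) a)) (trans (L-* a f) (*-comm a (L f)))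

  L-0 : L (λ _ → 0ℚ) ≡ 0ℚ
  L-0 = trans (L-* 0ℚ (λ _ → 0ℚ)) (*-zeroˡ (L (λ _ → 0ℚ)))

  L-nonneg : ∀ {f} → (∀ i → 0ℚ ≤ f i) → 0ℚ ≤ L f
  L-nonneg {f} 0≤f = subst (_≤ L f) L-0 (L-mono 0≤f)

  -- A summand is first rewritten pointwise into this right-nested form, ending in `0ℚ`;
  -- `L-combination` then yields the same expression in the values of `L`.
  combination : List (ℚ × (I → ℚ)) → I → ℚ
  combination []              i = 0ℚ
  combination ((a , f) ∷ afs) i = a * f i + combination afs i

  L-values : List (ℚ × (I → ℚ)) → ℚ
  L-values []              = 0ℚ
  L-values ((a , f) ∷ afs) = a * L f + L-values afs

  L-combination : ∀ afs → L (combination afs) ≡ L-values afs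
  L-combination []              = L-0
  L-combination ((a , f) ∷ afs) =
    trans (L-+ (λ i → a * f i) (combination afs)) (cong₂ _+_ (L-* a f) (L-combination afs))

  -- Linearity alone moves a finite sum through `L`; when `L` is itself a sum, this is interchange
  -- of summation.
  L-sumℚ : ∀ {n} (f : I → Fin n → ℚ) → L (λ i → sumℚ n (f i)) ≡ sumℚ n (λ j → L (λ i → f i j))
  L-sumℚ {zero}  f = L-0
  L-sumℚ {suc n} f =
    trans (L-+ (λ i → f i zero) (λ i → sumℚ n (f i ∘ suc))) (+-congˡ (L (λ i → f i zero)) (L-sumℚ (λ i → f i ∘ suc)))

  -- Positivity applied to (L 1 · f − L f)².
  cauchy-schwarz : 0ℚ < L (λ _ → 1ℚ) → ∀ f → L f * L f ≤ L (λ _ → 1ℚ) * L (λ i → f i * f i)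
  cauchy-schwarz 0<m f = 0≤q-p⇒p≤q (*-cancelˡ-≤ 0<m (subst₂ _≤_ (sym (*-zeroʳ m)) eq (L-nonneg (λ i → square-nonneg (m * f i - s)))))
    where
    m = L (λ _ → 1ℚ)
    s = L f
    t = L (λ i → f i * f i)
    terms = (m * m , λ i → f i * f i) ∷ (- (2ℚ * m * s) , f) ∷ (s * s , λ _ → 1ℚ) ∷ []
    eq : L (λ i → (m * f i - s) * (m * f i - s)) ≡ m * (m * t - s * s)
    eq = begin
      L (λ i → (m * f i - s) * (m * f i - s)) ≡⟨ L-cong (λ i → solve 3 (λ m s x → (m :* x :- s) :* (m :* x :- s)
                                                    := m :* m :* (x :* x) :+ (:- (con 2ℚ :* m :* s) :* x :+ (s :* s :* con 1ℚ :+ con 0ℚ))) refl m s (f i)) ⟩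
      L (combination terms)                   ≡⟨ L-combination terms ⟩
      L-values terms                          ≡⟨ solve 3 (λ m s t → m :* m :* t :+ (:- (con 2ℚ :* m :* s) :* s :+ (s :* s :* m :+ con 0ℚ))
                                                    := m :* (m :* t :- s :* s)) refl m s t ⟩
      m * (m * t - s * s)                     ∎
      where open ≡-Reasoning

open Positive-Linear

sumℚ-linear : ∀ n → Positive-Linear (sumℚ n)
sumℚ-linear zero = record
  { L-cong = λ _ → refl ; L-+ = λ _ _ → refl ; L-* = λ a _ → sym (*-zeroʳ a) ; L-mono = λ _ → ≤-refl }
sumℚ-linear (suc n) = record
  { L-cong = λ f≡g → cong₂ _+_ (f≡g zero) (L-cong (sumℚ-linear n) (f≡g ∘ suc))
  ; L-+    = λ f g → trans (+-congˡ (f zero + g zero) (L-+ (sumℚ-linear n) (f ∘ suc) (g ∘ suc)))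
      (solve 4 (λ a b c d → a :+ b :+ (c :+ d) := a :+ c :+ (b :+ d)) refl (f zero) (g zero) (sumℚ n (f ∘ suc)) (sumℚ n (g ∘ suc)))
  ; L-*    = λ a f → trans (+-congˡ (a * f zero) (L-* (sumℚ-linear n) a (f ∘ suc))) (sym (*-distribˡ-+ a (f zero) _))
  ; L-mono = λ f≤g → +-mono-≤ (f≤g zero) (L-mono (sumℚ-linear n) (f≤g ∘ suc))
  }

infixr 2 _⊗_
_⊗_ : {I J : Set} → ((I → ℚ) → ℚ) → ((J → ℚ) → ℚ) → (I × J → ℚ) → ℚ
(L ⊗ M) f = L (λ i → M (λ j → f (i , j)))

⊗-linear : {I J : Set} {L : (I → ℚ) → ℚ} {M : (J → ℚ) → ℚ} →
  Positive-Linear L → Positive-Linear M → Positive-Linear (L ⊗ M)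
⊗-linear ℓ m = record
  { L-cong = λ f≡g → L-cong ℓ (λ i → L-cong m (λ j → f≡g (i , j)))
  ; L-+    = λ f g → trans (L-cong ℓ (λ i → L-+ m (λ j → f (i , j)) (λ j → g (i , j)))) (L-+ ℓ _ _)
  ; L-*    = λ a f → trans (L-cong ℓ (λ i → L-* m a (λ j → f (i , j)))) (L-* ℓ a _)
  ; L-mono = λ f≤g → L-mono ℓ (λ i → L-mono m (λ j → f≤g (i , j)))
  }

-- The embedding of ℕ

-- `ℕ→ℚ k` is normalised by a gcd and does not compute for variable `k`, so facts about it are moved
-- to the unnormalised fraction k/1, whose `0` is the denominator minus one.
toℚᵘ-ℕ→ℚ : ∀ k → toℚᵘ (ℕ→ℚ k) ℚᵘ.≃ ℚᵘ.mkℚᵘ (+ k) 0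
toℚᵘ-ℕ→ℚ k = toℚᵘ-fromℚᵘ (ℚᵘ.mkℚᵘ (+ k) 0)

ℕ→ℚ-+ : ∀ a b → ℕ→ℚ (a ℕ.+ b) ≡ ℕ→ℚ a + ℕ→ℚ b
ℕ→ℚ-+ a b = toℚᵘ-injective (begin
  toℚᵘ (ℕ→ℚ (a ℕ.+ b))                          ≈⟨ toℚᵘ-ℕ→ℚ (a ℕ.+ b) ⟩
  ℚᵘ.mkℚᵘ (+ (a ℕ.+ b)) 0                       ≈⟨ ℚᵘ.*≡* (cong (ℤ._* + 1) (sym (cong₂ ℤ._+_ (ℤ.*-identityʳ (+ a)) (ℤ.*-identityʳ (+ b))))) ⟩
  ℚᵘ.mkℚᵘ (+ a) 0 ℚᵘ.+ ℚᵘ.mkℚᵘ (+ b) 0          ≈⟨ ℚᵘ.+-cong (toℚᵘ-ℕ→ℚ a) (toℚᵘ-ℕ→ℚ b) ⟨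
  toℚᵘ (ℕ→ℚ a) ℚᵘ.+ toℚᵘ (ℕ→ℚ b)                ≈⟨ toℚᵘ-homo-+ (ℕ→ℚ a) (ℕ→ℚ b) ⟨
  toℚᵘ (ℕ→ℚ a + ℕ→ℚ b)                          ∎)
  where open ℚᵘ.≃-Reasoning

ℕ→ℚ-* : ∀ a b → ℕ→ℚ (a ℕ.* b) ≡ ℕ→ℚ a * ℕ→ℚ b
ℕ→ℚ-* zero    b = sym (*-zeroˡ (ℕ→ℚ b))
ℕ→ℚ-* (suc a) b = begin
  ℕ→ℚ (b ℕ.+ a ℕ.* b)           ≡⟨ ℕ→ℚ-+ b (a ℕ.* b) ⟩
  ℕ→ℚ b + ℕ→ℚ (a ℕ.* b)         ≡⟨ +-congˡ (ℕ→ℚ b) (ℕ→ℚ-* a b) ⟩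
  ℕ→ℚ b + ℕ→ℚ a * ℕ→ℚ b         ≡⟨ solve 2 (λ x y → y :+ x :* y := (con 1ℚ :+ x) :* y) refl (ℕ→ℚ a) (ℕ→ℚ b) ⟩
  (1ℚ + ℕ→ℚ a) * ℕ→ℚ b          ≡⟨ cong (_* ℕ→ℚ b) (ℕ→ℚ-+ 1 a) ⟨
  ℕ→ℚ (suc a) * ℕ→ℚ b           ∎
  where open ≡-Reasoning

ℕ→ℚ-mono-≤ : ∀ {a b} → a ℕ.≤ b → ℕ→ℚ a ≤ ℕ→ℚ b
ℕ→ℚ-mono-≤ {a} {b} a≤b = toℚᵘ-cancel-≤ (begin
  toℚᵘ (ℕ→ℚ a)       ≃⟨ toℚᵘ-ℕ→ℚ a ⟩
  ℚᵘ.mkℚᵘ (+ a) 0    ≤⟨ ℚᵘ.*≤* (ℤ.*-monoʳ-≤-nonNeg (+ 1) (ℤ.+≤+ a≤b)) ⟩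
  ℚᵘ.mkℚᵘ (+ b) 0    ≃⟨ toℚᵘ-ℕ→ℚ b ⟨
  toℚᵘ (ℕ→ℚ b)       ∎)
  where open ℚᵘ.≤-Reasoning

ℕ→ℚ-sumℕ : ∀ {n} (f : Fin n → ℕ) → ℕ→ℚ (sumℕ n f) ≡ sumℚ n (ℕ→ℚ ∘ f)
ℕ→ℚ-sumℕ {zero}  f = refl
ℕ→ℚ-sumℕ {suc n} f = trans (ℕ→ℚ-+ (f zero) _) (+-congˡ (ℕ→ℚ (f zero)) (ℕ→ℚ-sumℕ (f ∘ suc)))

sumℚ-const : ∀ n a → sumℚ n (λ _ → a) ≡ ℕ→ℚ n * a
sumℚ-const zero    a = sym (*-zeroˡ a)
sumℚ-const (suc n) a = begin
  a + sumℚ n (λ _ → a)    ≡⟨ +-congˡ a (sumℚ-const n a) ⟩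
  a + ℕ→ℚ n * a           ≡⟨ solve 2 (λ x y → y :+ x :* y := (con 1ℚ :+ x) :* y) refl (ℕ→ℚ n) a ⟩
  (1ℚ + ℕ→ℚ n) * a        ≡⟨ cong (_* a) (ℕ→ℚ-+ 1 n) ⟨
  ℕ→ℚ (suc n) * a         ∎
  where open ≡-Reasoning

-- Doubling avoids division; the induction step is Pascal's rule.
2*nC2 : ∀ n → 2ℚ * ℕ→ℚ (n C 2) ≡ ℕ→ℚ n * ℕ→ℚ n - ℕ→ℚ n
2*nC2 zero    = refl
2*nC2 (suc n) = begin
  2ℚ * ℕ→ℚ (suc n C 2)                     ≡⟨ cong (λ k → 2ℚ * ℕ→ℚ k) (nCk+nC[k+1]≡[n+1]C[k+1] n 1) ⟨
  2ℚ * ℕ→ℚ (n C 1 ℕ.+ n C 2)               ≡⟨ cong (2ℚ *_) (ℕ→ℚ-+ (n C 1) (n C 2)) ⟩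
  2ℚ * (ℕ→ℚ (n C 1) + ℕ→ℚ (n C 2))         ≡⟨ cong (λ k → 2ℚ * (ℕ→ℚ k + ℕ→ℚ (n C 2))) (nC1≡n n) ⟩
  2ℚ * (x + ℕ→ℚ (n C 2))                   ≡⟨ *-distribˡ-+ 2ℚ x (ℕ→ℚ (n C 2)) ⟩
  2ℚ * x + 2ℚ * ℕ→ℚ (n C 2)                ≡⟨ +-congˡ (2ℚ * x) (2*nC2 n) ⟩
  2ℚ * x + (x * x - x)                     ≡⟨ solve 1 (λ x → con 2ℚ :* x :+ (x :* x :- x) := (con 1ℚ :+ x) :* (con 1ℚ :+ x) :- (con 1ℚ :+ x)) refl x ⟩
  (1ℚ + x) * (1ℚ + x) - (1ℚ + x)           ≡⟨ cong (λ y → y * y - y) (ℕ→ℚ-+ 1 n) ⟨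
  ℕ→ℚ (suc n) * ℕ→ℚ (suc n) - ℕ→ℚ (suc n)  ∎
  where
  x = ℕ→ℚ n
  open ≡-Reasoning

-- Sums over pairs and quadruples of vertices

pairs : ∀ n → (Fin n × Fin n → ℚ) → ℚ
pairs n = sumℚ n ⊗ sumℚ n

pairs-linear : ∀ n → Positive-Linear (pairs n)
pairs-linear n = ⊗-linear (sumℚ-linear n) (sumℚ-linear n)

pairs-swap : ∀ {n} (f : Fin n → Fin n → ℚ) → pairs n (λ (x , y) → f x y) ≡ pairs n (λ (x , y) → f y x)
pairs-swap {n} f = L-sumℚ (sumℚ-linear n) f

pairs-fst : ∀ {n} (f : Fin n → ℚ) → pairs n (λ (x , y) → f x) ≡ ℕ→ℚ n * sumℚ n f
pairs-fst {n} f = trans (L-cong (sumℚ-linear n) (λ x → sumℚ-const n (f x))) (L-* (sumℚ-linear n) (ℕ→ℚ n) f)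

pairs-snd : ∀ {n} (f : Fin n → ℚ) → pairs n (λ (x , y) → f y) ≡ ℕ→ℚ n * sumℚ n f
pairs-snd {n} f = sumℚ-const n (sumℚ n f)

pairs-product : ∀ {n} (f g : Fin n → ℚ) → pairs n (λ (x , y) → f x * g y) ≡ sumℚ n f * sumℚ n g
pairs-product {n} f g =
  trans (L-cong (sumℚ-linear n) (λ x → L-* (sumℚ-linear n) (f x) g)) (L-*ʳ (sumℚ-linear n) (sumℚ n g) f)

pairs-const : ∀ n a → pairs n (λ _ → a) ≡ ℕ→ℚ n * ℕ→ℚ n * a
pairs-const n a = begin
  pairs n (λ _ → a)                  ≡⟨ pairs-fst {n} (λ _ → a) ⟩
  ℕ→ℚ n * sumℚ n (λ _ → a)           ≡⟨ cong (ℕ→ℚ n *_) (sumℚ-const n a) ⟩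
  ℕ→ℚ n * (ℕ→ℚ n * a)                ≡⟨ *-assoc (ℕ→ℚ n) (ℕ→ℚ n) a ⟨
  ℕ→ℚ n * ℕ→ℚ n * a                  ∎
  where open ≡-Reasoning

Quad : ℕ → Set
Quad n = Fin n × Fin n × Fin n × Fin n

quads : ∀ n → (Quad n → ℚ) → ℚ
quads n = sumℚ n ⊗ sumℚ n ⊗ sumℚ n ⊗ sumℚ n

triples-linear : ∀ n → Positive-Linear (sumℚ n ⊗ sumℚ n ⊗ sumℚ n)
triples-linear n = ⊗-linear (sumℚ-linear n) (pairs-linear n)

quads-linear : ∀ n → Positive-Linear (quads n)
quads-linear n = ⊗-linear (sumℚ-linear n) (triples-linear n)

rotate : ∀ {n} → Quad n → Quad n
rotate (a , b , c , d) = b , c , d , a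

-- Only the order of summation changes: the sum over `a` moves inside the other three.
quads-rotate : ∀ {n} (f : Quad n → ℚ) → quads n (f ∘ rotate) ≡ quads n f
quads-rotate {n} f = sym (L-sumℚ (triples-linear n) (λ (b , c , d) a → f (b , c , d , a)))

-- Moments of a symmetric matrix

module Moments {n : ℕ} (A : Fin n → Fin n → ℚ) (A-sym : ∀ x y → A x y ≡ A y x) where

  Σᵥ = sumℚ-linear n
  Σₚ = pairs-linear n

  deg : Fin n → ℚ
  deg x = sumℚ n (A x)

  cod : Fin n → Fin n → ℚ
  cod x y = sumℚ n (λ z → A x z * A y z)

  -- For a 0/1 matrix, `S`, `V` and `W` count walks with one, two and three edges, and `Q` counts
  -- closed walks with four.
  N S V W Q : ℚ
  N = ℕ→ℚ n
  S = sumℚ n deg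
  V = sumℚ n (λ x → deg x * deg x)
  W = pairs n (λ (x , y) → cod x y * deg y)
  Q = pairs n (λ (x , y) → cod x y * cod x y)

  cod-sym : ∀ x y → cod x y ≡ cod y x
  cod-sym x y = L-cong Σᵥ (λ z → *-comm (A x z) (A y z))

  -- Summing over the common neighbour `z` last leaves the two ends free, which gives the square of
  -- the degree of `z`.
  pairs-cod : pairs n (λ (x , y) → cod x y) ≡ V
  pairs-cod = begin
    pairs n (λ (x , y) → sumℚ n (λ z → A x z * A y z))  ≡⟨ L-sumℚ Σₚ (λ (x , y) z → A x z * A y z) ⟩
    sumℚ n (λ z → pairs n (λ (x , y) → A x z * A y z))  ≡⟨ L-cong Σᵥ (λ z → pairs-product (λ x → A x z) (λ y → A y z)) ⟩
    sumℚ n (λ z → sumℚ n (λ x → A x z) * sumℚ n (λ y → A y z))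
      ≡⟨ L-cong Σᵥ (λ z → cong₂ _*_ (L-cong Σᵥ (λ x → A-sym x z)) (L-cong Σᵥ (λ y → A-sym y z))) ⟩
    V ∎
    where open ≡-Reasoning

  pairs-cod*deg : pairs n (λ (x , y) → cod x y * deg x) ≡ W
  pairs-cod*deg = trans (pairs-swap (λ x y → cod x y * deg x)) (L-cong Σₚ (λ (x , y) → cong (_* deg y) (cod-sym y x)))

  path cycle : Quad n → ℚ
  path  (a , b , c , d) = A a b * A b c * A c d
  cycle (a , b , c , d) = A a b * A b c * A c d * A d a

  -- Once the first and third vertices are fixed, the second and fourth vary independently; hence
  -- the swap that moves `c` outwards and the factorisation.
  quads-path : quads n path ≡ W
  quads-path = L-cong Σᵥ (λ a → trans (pairs-swap (λ b c → sumℚ n (λ d → path (a , b , c , d)))) (L-cong Σᵥ (λ c → begin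
    pairs n (λ (b , d) → A a b * A b c * A c d)      ≡⟨ pairs-product (λ b → A a b * A b c) (A c) ⟩
    sumℚ n (λ b → A a b * A b c) * deg c             ≡⟨ cong (_* deg c) (L-cong Σᵥ (λ b → cong (A a b *_) (A-sym b c))) ⟩
    cod a c * deg c                                  ∎)))
    where open ≡-Reasoning

  quads-cycle : quads n cycle ≡ Q
  quads-cycle = L-cong Σᵥ (λ a → trans (pairs-swap (λ b c → sumℚ n (λ d → cycle (a , b , c , d)))) (L-cong Σᵥ (λ c → begin
    pairs n (λ (b , d) → A a b * A b c * A c d * A d a)
      ≡⟨ L-cong Σₚ (λ (b , d) → trans (*-assoc (A a b * A b c) (A c d) (A d a))
                                      (cong₂ _*_ (cong (A a b *_) (A-sym b c)) (trans (*-comm (A c d) (A d a)) (cong (_* A c d) (A-sym d a))))) ⟩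
    pairs n (λ (b , d) → A a b * A c b * (A a d * A c d))  ≡⟨ pairs-product (λ b → A a b * A c b) (λ d → A a d * A c d) ⟩
    cod a c * cod a c                                      ∎)))
    where open ≡-Reasoning

  open Positive-Linear (quads-linear n) using () renaming (combination to quad-combination)

  -- On a 0/1 matrix this is at least 1 at each quadruple with exactly three unit entries, and never negative.
  cyclic-terms : List (ℚ × (Quad n → ℚ))
  cyclic-terms = (1ℚ , path) ∷ (1ℚ , path ∘ rotate) ∷ (1ℚ , path ∘ rotate ∘ rotate) ∷ (1ℚ , path ∘ rotate ∘ rotate ∘ rotate)
    ∷ (- 4ℚ , cycle) ∷ []

  -- Every rotation of `path` has the same sum `W`.
  quads-cyclic : quads n (quad-combination cyclic-terms) ≡ 4ℚ * (W - Q)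
  quads-cyclic = begin
    quads n (quad-combination cyclic-terms)  ≡⟨ L-combination (quads-linear n) cyclic-terms ⟩
    1ℚ * quads n path + (1ℚ * quads n (path ∘ rotate) + (1ℚ * quads n (path ∘ rotate ∘ rotate)
      + (1ℚ * quads n (path ∘ rotate ∘ rotate ∘ rotate) + (- 4ℚ * quads n cycle + 0ℚ))))
      ≡⟨ collect quads-path r₁ r₂ r₃ quads-cycle ⟩
    1ℚ * W + (1ℚ * W + (1ℚ * W + (1ℚ * W + (- 4ℚ * Q + 0ℚ))))
      ≡⟨ solve 2 (λ w q → con 1ℚ :* w :+ (con 1ℚ :* w :+ (con 1ℚ :* w :+ (con 1ℚ :* w :+ (con (- 4ℚ) :* q :+ con 0ℚ))))
                          := con 4ℚ :* (w :- q)) refl W Q ⟩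
    4ℚ * (W - Q) ∎
    where
    open ≡-Reasoning
    r₁ = trans (quads-rotate path) quads-path
    r₂ = trans (quads-rotate (path ∘ rotate)) r₁
    r₃ = trans (quads-rotate (path ∘ rotate ∘ rotate)) r₂
    -- Rewrites all five sums at once: with variables on both sides, each equation can be matched
    -- with `refl`.
    collect : ∀ {a b c d e a′ b′ c′ d′ e′} → a ≡ a′ → b ≡ b′ → c ≡ c′ → d ≡ d′ → e ≡ e′ →
      1ℚ * a + (1ℚ * b + (1ℚ * c + (1ℚ * d + (- 4ℚ * e + 0ℚ)))) ≡ 1ℚ * a′ + (1ℚ * b′ + (1ℚ * c′ + (1ℚ * d′ + (- 4ℚ * e′ + 0ℚ))))
    collect refl refl refl refl refl = refl

  -- Degree variance and codegree residuals

  spread : ℚ → ℚ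
  spread p = sumℚ n (λ x → (deg x - p * N) * (deg x - p * N))

  spread-expand : ∀ p → spread p ≡ V - 2ℚ * (p * N * S) + p * p * (N * N * N)
  spread-expand p = begin
    spread p ≡⟨ L-cong Σᵥ (λ x → solve 3 (λ p m d → (d :- p :* m) :* (d :- p :* m)
                  := con 1ℚ :* (d :* d) :+ (con (- 2ℚ) :* (p :* m) :* d :+ (p :* p :* (m :* m) :* con 1ℚ :+ con 0ℚ))) refl p N (deg x)) ⟩
    sumℚ n (Positive-Linear.combination Σᵥ terms)                         ≡⟨ L-combination Σᵥ terms ⟩
    1ℚ * V + (- 2ℚ * (p * N) * S + (p * p * (N * N) * sumℚ n (λ _ → 1ℚ) + 0ℚ))
      ≡⟨ cong (λ t → 1ℚ * V + (- 2ℚ * (p * N) * S + (p * p * (N * N) * t + 0ℚ))) (sumℚ-const n 1ℚ) ⟩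
    1ℚ * V + (- 2ℚ * (p * N) * S + (p * p * (N * N) * (N * 1ℚ) + 0ℚ))
      ≡⟨ solve 4 (λ p m s v → con 1ℚ :* v :+ (con (- 2ℚ) :* (p :* m) :* s :+ (p :* p :* (m :* m) :* (m :* con 1ℚ) :+ con 0ℚ))
            := v :- con 2ℚ :* (p :* m :* s) :+ p :* p :* (m :* m :* m)) refl p N S V ⟩
    V - 2ℚ * (p * N * S) + p * p * (N * N * N) ∎
    where
    open ≡-Reasoning
    terms : List (ℚ × (Fin n → ℚ))
    terms = (1ℚ , λ x → deg x * deg x) ∷ (- 2ℚ * (p * N) , deg) ∷ (p * p * (N * N) , λ _ → 1ℚ) ∷ []

  -- By symmetry `Q - W` is the sum of c² - ½c(d + e) over pairs, and completing the square centres
  -- c at ¼(d + e). The shift `k` will be (p² - p/2)N, so that the residual vanishes when all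
  -- degrees are pN and all codegrees p²N.
  residual : ℚ → Fin n → Fin n → ℚ
  residual k x y = cod x y - ¼ * (deg x + deg y) - k

  -- The codegrees enter linearly, so only degrees survive. With `S` = pN² and k = (p² - p/2)N the
  -- value would be exactly `spread p`.
  pairs-residual : ∀ k → pairs n (λ (x , y) → residual k x y) ≡ V - ½ * (N * S) - k * (N * N)
  pairs-residual k = begin
    pairs n (λ (x , y) → residual k x y)
      ≡⟨ L-cong Σₚ (λ (x , y) → solve 4 (λ k c d e → c :- con ¼ :* (d :+ e) :- k
           := con 1ℚ :* c :+ (con (- ¼) :* d :+ (con (- ¼) :* e :+ ((:- k) :* con 1ℚ :+ con 0ℚ)))) refl k (cod x y) (deg x) (deg y)) ⟩
    pairs n (Positive-Linear.combination Σₚ terms) ≡⟨ L-combination Σₚ terms ⟩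
    Positive-Linear.L-values Σₚ terms
      ≡⟨ collect pairs-cod (pairs-fst deg) (pairs-snd deg) (pairs-const n 1ℚ) ⟩
    1ℚ * V + (- ¼ * (N * S) + (- ¼ * (N * S) + (- k * (N * N * 1ℚ) + 0ℚ)))
      ≡⟨ solve 4 (λ k m s v → con 1ℚ :* v :+ (con (- ¼) :* (m :* s) :+ (con (- ¼) :* (m :* s) :+ ((:- k) :* (m :* m :* con 1ℚ) :+ con 0ℚ)))
            := v :- con ½ :* (m :* s) :- k :* (m :* m)) refl k N S V ⟩
    V - ½ * (N * S) - k * (N * N) ∎
    where
    open ≡-Reasoning
    terms : List (ℚ × (Fin n × Fin n → ℚ))
    terms = (1ℚ , λ (x , y) → cod x y) ∷ (- ¼ , λ (x , y) → deg x) ∷ (- ¼ , λ (x , y) → deg y) ∷ (- k , λ _ → 1ℚ) ∷ []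
    collect : ∀ {a b c d a′ b′ c′ d′} → a ≡ a′ → b ≡ b′ → c ≡ c′ → d ≡ d′ →
      1ℚ * a + (- ¼ * b + (- ¼ * c + (- k * d + 0ℚ))) ≡ 1ℚ * a′ + (- ¼ * b′ + (- ¼ * c′ + (- k * d′ + 0ℚ)))
    collect refl refl refl refl = refl

  -- The two cross terms of codegree and degree contribute -½W each, so apart from `Q - W` only `N`,
  -- `S` and `V` remain.
  pairs-residual² : ∀ k → pairs n (λ (x , y) → residual k x y * residual k x y)
    ≡ Q + ⅛ * (N * V) + ⅛ * (S * S) + k * k * (N * N) - W - 2ℚ * (k * V) + k * (S * N)
  pairs-residual² k = begin
    pairs n (λ (x , y) → residual k x y * residual k x y)
      ≡⟨ L-cong Σₚ (λ (x , y) → solve 4 (λ k c d e → (c :- con ¼ :* (d :+ e) :- k) :* (c :- con ¼ :* (d :+ e) :- k)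
           := con 1ℚ :* (c :* c) :+ (con (- ½) :* (c :* d) :+ (con (- ½) :* (c :* e) :+ (con (- 2ℚ) :* k :* c
           :+ (con (+ 1 / 16) :* (d :* d) :+ (con (+ 1 / 16) :* (e :* e) :+ (con ⅛ :* (d :* e)
           :+ (con ½ :* k :* d :+ (con ½ :* k :* e :+ (k :* k :* con 1ℚ :+ con 0ℚ)))))))))) refl k (cod x y) (deg x) (deg y)) ⟩
    pairs n (Positive-Linear.combination Σₚ terms) ≡⟨ L-combination Σₚ terms ⟩
    Positive-Linear.L-values Σₚ terms
      ≡⟨ collect pairs-cod*deg pairs-cod (pairs-fst (λ x → deg x * deg x)) (pairs-snd (λ x → deg x * deg x)) (pairs-product deg deg)
                 (pairs-fst deg) (pairs-snd deg) (pairs-const n 1ℚ) ⟩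
    1ℚ * Q + (- ½ * W + (- ½ * W + (- 2ℚ * k * V + (+ 1 / 16 * (N * V) + (+ 1 / 16 * (N * V) + (⅛ * (S * S)
      + (½ * k * (N * S) + (½ * k * (N * S) + (k * k * (N * N * 1ℚ) + 0ℚ)))))))))
      ≡⟨ solve 6 (λ k m s v w q →
           con 1ℚ :* q :+ (con (- ½) :* w :+ (con (- ½) :* w :+ (con (- 2ℚ) :* k :* v
           :+ (con (+ 1 / 16) :* (m :* v) :+ (con (+ 1 / 16) :* (m :* v) :+ (con ⅛ :* (s :* s)
           :+ (con ½ :* k :* (m :* s) :+ (con ½ :* k :* (m :* s) :+ (k :* k :* (m :* m :* con 1ℚ) :+ con 0ℚ)))))))))
           := q :+ con ⅛ :* (m :* v) :+ con ⅛ :* (s :* s) :+ k :* k :* (m :* m) :- w :- con 2ℚ :* (k :* v) :+ k :* (s :* m))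
           refl k N S V W Q ⟩
    Q + ⅛ * (N * V) + ⅛ * (S * S) + k * k * (N * N) - W - 2ℚ * (k * V) + k * (S * N) ∎
    where
    open ≡-Reasoning
    terms : List (ℚ × (Fin n × Fin n → ℚ))
    terms = (1ℚ , λ (x , y) → cod x y * cod x y) ∷ (- ½ , λ (x , y) → cod x y * deg x) ∷ (- ½ , λ (x , y) → cod x y * deg y)
      ∷ (- 2ℚ * k , λ (x , y) → cod x y) ∷ (+ 1 / 16 , λ (x , y) → deg x * deg x) ∷ (+ 1 / 16 , λ (x , y) → deg y * deg y)
      ∷ (⅛ , λ (x , y) → deg x * deg y) ∷ (½ * k , λ (x , y) → deg x) ∷ (½ * k , λ (x , y) → deg y) ∷ (k * k , λ _ → 1ℚ) ∷ []
    collect : ∀ {b d e f g h i j b′ d′ e′ f′ g′ h′ i′ j′} →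
      b ≡ b′ → d ≡ d′ → e ≡ e′ → f ≡ f′ → g ≡ g′ → h ≡ h′ → i ≡ i′ → j ≡ j′ →
      1ℚ * Q + (- ½ * b + (- ½ * W + (- 2ℚ * k * d + (+ 1 / 16 * e + (+ 1 / 16 * f + (⅛ * g + (½ * k * h + (½ * k * i + (k * k * j + 0ℚ)))))))))
      ≡ 1ℚ * Q + (- ½ * b′ + (- ½ * W + (- 2ℚ * k * d′ + (+ 1 / 16 * e′ + (+ 1 / 16 * f′ + (⅛ * g′ + (½ * k * h′ + (½ * k * i′ + (k * k * j′ + 0ℚ)))))))))
    collect refl refl refl refl refl refl refl refl = refl

  -- (r + w)² ≤ 2r² + 2w² for w = ¼(u + v), followed by (u + v)² ≤ 2u² + 2v². The final `0ℚ` fits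
  -- the shape of `combination`.
  square-bound : ∀ r u v → (r + ¼ * (u + v)) * (r + ¼ * (u + v)) ≤ 2ℚ * (r * r) + (¼ * (u * u) + (¼ * (v * v) + 0ℚ))
  square-bound r u v = ≤-by-difference
    (solve 3 (λ r u v → con 2ℚ :* (r :* r) :+ (con ¼ :* (u :* u) :+ (con ¼ :* (v :* v) :+ con 0ℚ)) :- (r :+ con ¼ :* (u :+ v)) :* (r :+ con ¼ :* (u :+ v))
       := (r :- con ¼ :* (u :+ v)) :* (r :- con ¼ :* (u :+ v)) :+ con ⅛ :* ((u :- v) :* (u :- v))) refl r u v)
    (+-nonneg (square-nonneg (r - ¼ * (u + v))) (*-nonneg (from-yes (0ℚ ≤? ⅛)) (square-nonneg (u - v))))

  -- For this shift, the deviation of a codegree from p²N is its residual plus a quarter of the sum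
  -- of the two degree deviations.
  codegree-variance : ∀ p → pairs n (λ (x , y) → (cod x y - p * p * N) * (cod x y - p * p * N))
    ≤ 2ℚ * pairs n (λ (x , y) → residual ((p * p - ½ * p) * N) x y * residual ((p * p - ½ * p) * N) x y) + ½ * (N * spread p)
  codegree-variance p = begin
    pairs n (λ (x , y) → (cod x y - p * p * N) * (cod x y - p * p * N))
      ≡⟨ L-cong Σₚ (λ (x , y) → cong (λ t → t * t) (solve 5 (λ p m c d e →
           c :- p :* p :* m := c :- con ¼ :* (d :+ e) :- (p :* p :- con ½ :* p) :* m :+ con ¼ :* (d :- p :* m :+ (e :- p :* m)))
           refl p N (cod x y) (deg x) (deg y))) ⟩
    pairs n (λ (x , y) → (residual k x y + ¼ * (dev x + dev y)) * (residual k x y + ¼ * (dev x + dev y)))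
      ≤⟨ L-mono Σₚ (λ (x , y) → square-bound (residual k x y) (dev x) (dev y)) ⟩
    pairs n (Positive-Linear.combination Σₚ terms) ≡⟨ L-combination Σₚ terms ⟩
    Positive-Linear.L-values Σₚ terms ≡⟨ collect (pairs-fst (λ x → dev x * dev x)) (pairs-snd (λ x → dev x * dev x)) ⟩
    2ℚ * R + (¼ * (N * spread p) + (¼ * (N * spread p) + 0ℚ))
      ≡⟨ solve 2 (λ r t → con 2ℚ :* r :+ (con ¼ :* t :+ (con ¼ :* t :+ con 0ℚ)) := con 2ℚ :* r :+ con ½ :* t) refl R (N * spread p) ⟩
    2ℚ * R + ½ * (N * spread p) ∎
    where
    open ≤-Reasoning
    k = (p * p - ½ * p) * N
    R = pairs n (λ (x , y) → residual k x y * residual k x y)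
    dev : Fin n → ℚ
    dev x = deg x - p * N
    terms : List (ℚ × (Fin n × Fin n → ℚ))
    terms = (2ℚ , λ (x , y) → residual k x y * residual k x y) ∷ (¼ , λ (x , y) → dev x * dev x) ∷ (¼ , λ (x , y) → dev y * dev y) ∷ []
    collect : ∀ {a b a′ b′} → a ≡ a′ → b ≡ b′ → 2ℚ * R + (¼ * a + (¼ * b + 0ℚ)) ≡ 2ℚ * R + (¼ * a′ + (¼ * b′ + 0ℚ))
    collect refl refl = refl

-- The extremal inequality and its stability

-- Mirrors the recursion of `_^ℚ_`, so that solver polynomials denote the powers in the goals
-- definitionally.
pow : ∀ {m} → Polynomial m → ℕ → Polynomial m
pow x zero    = con 1ℚ
pow x (suc k) = x :* pow x k

^-pos : ∀ {p} → 0ℚ < p → ∀ k → 0ℚ < p ^ℚ k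
^-pos 0<p zero    = from-yes (0ℚ <? 1ℚ)
^-pos 0<p (suc k) = *-pos 0<p (^-pos 0<p k)

^-nonneg : ∀ {p} → 0ℚ ≤ p → ∀ k → 0ℚ ≤ p ^ℚ k
^-nonneg 0≤p zero    = from-yes (0ℚ ≤? 1ℚ)
^-nonneg 0≤p (suc k) = *-nonneg 0≤p (^-nonneg 0≤p k)

-- The hypothesis on p is 2p² − p − 1/8 ≥ 0, i.e. the coefficient of the degree variance is nonnegative.
energy-bound : ∀ p N S V W Q → S ≡ p * (N * N - N) → 0ℚ ≤ p → p ≤ 1ℚ → 2ℚ ≤ (4ℚ * p - 1ℚ) * (4ℚ * p - 1ℚ) → 1ℚ ≤ N →
  0ℚ ≤ V - 2ℚ * (p * N * S) + p * p * (N * N * N) →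
  let k = (p * p - ½ * p) * N in
  Q + ⅛ * (N * V) + ⅛ * (S * S) + k * k * (N * N) - W - 2ℚ * (k * V) + k * (S * N)
    ≤ p ^ℚ 3 * (1ℚ - p) * N ^ℚ 4 + 2ℚ * N ^ℚ 3 - (W - Q)
energy-bound p N _ V W Q refl 0≤p p≤1 hyp 1≤N 0≤v = ≤-by-difference
  (solve 5 (λ p N V W Q →
    let S = p :* (N :* N :- N)
        k = (p :* p :- con ½ :* p) :* N
        Z = Q :+ con ⅛ :* (N :* V) :+ con ⅛ :* (S :* S) :+ k :* k :* (N :* N) :- W :- con 2ℚ :* (k :* V) :+ k :* (S :* N)
        v = V :- con 2ℚ :* (p :* N :* S) :+ p :* p :* (N :* N :* N)
        q = con 4ℚ :* p :- con 1ℚ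
    in pow p 3 :* (con 1ℚ :- p) :* pow N 4 :+ con 2ℚ :* pow N 3 :- (W :- Q) :- Z
      -- The first summand is the degree variance with its coefficient 2p² - p - 1/8 = ⅛((4p - 1)² -
      -- 2). The others collect what remains of 2N³ after paying for `S` being pN² - pN instead of
      -- pN².
      := N :* (con ⅛ :* (q :* q :- con 2ℚ)) :* v
         :+ (pow N 3 :* ((con 1ℚ :- p) :* (con 1ℚ :+ p :+ p :* p :+ con 4ℚ :* (p :* p :* p)))
         :+ N :* N :* ((N :- con 1ℚ) :+ ((con 1ℚ :- p) :* (con 1ℚ :+ p) :+ con (+ 7 / 8) :* (p :* p))))) refl p N V W Q)
  (+-nonneg (*-nonneg (*-nonneg 0≤N (*-nonneg (from-yes (0ℚ ≤? ⅛)) (p≤q⇒0≤q-p hyp))) 0≤v)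
    (+-nonneg (*-nonneg (^-nonneg 0≤N 3) (*-nonneg 0≤1-p (+-nonneg (+-nonneg 0≤1+p (square-nonneg p))
                (*-nonneg (from-yes (0ℚ ≤? 4ℚ)) (*-nonneg (square-nonneg p) 0≤p)))))
      (*-nonneg (square-nonneg N) (+-nonneg (p≤q⇒0≤q-p 1≤N)
        (+-nonneg (*-nonneg 0≤1-p 0≤1+p) (*-nonneg (from-yes (0ℚ ≤? + 7 / 8)) (square-nonneg p)))))))
  where
  0≤N = ≤-trans (from-yes (0ℚ ≤? 1ℚ)) 1≤N
  0≤1-p = p≤q⇒0≤q-p p≤1
  0≤1+p = +-nonneg (from-yes (0ℚ ≤? 1ℚ)) 0≤p

-- Dropping Z ≥ 0 bounds D, and c ≤ ½D halves both terms: this is where the error constant 1 comes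
-- from.
energy⇒count : ∀ p N D Z c → 0ℚ ≤ Z → Z ≤ p ^ℚ 3 * (1ℚ - p) * N ^ℚ 4 + 2ℚ * N ^ℚ 3 - D → + 8 / 1 * c ≤ 4ℚ * D →
  c ≤ ½ * p ^ℚ 3 * (1ℚ - p) * N ^ℚ 4 + 1ℚ * N ^ℚ 3
energy⇒count p N D Z c 0≤Z Z≤ 8c≤4D = ≤-by-difference
  (solve 4 (λ p N D c → con ½ :* pow p 3 :* (con 1ℚ :- p) :* pow N 4 :+ con 1ℚ :* pow N 3 :- c
     := con ½ :* (pow p 3 :* (con 1ℚ :- p) :* pow N 4 :+ con 2ℚ :* pow N 3 :- D) :+ con ⅛ :* (con 4ℚ :* D :- con (+ 8 / 1) :* c))
     refl p N D c)
  (+-nonneg (*-nonneg (from-yes (0ℚ ≤? ½)) (≤-trans 0≤Z Z≤)) (*-nonneg (from-yes (0ℚ ≤? ⅛)) (p≤q⇒0≤q-p 8c≤4D)))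

-- Many cycles push D within 2δN⁴ of its main term; the error 2N³ costs another δN⁴ because 2 ≤ δN,
-- whence the 3.
count⇒energy : ∀ p N D Z c δ → 0ℚ ≤ N → 2ℚ ≤ δ * N → Z ≤ p ^ℚ 3 * (1ℚ - p) * N ^ℚ 4 + 2ℚ * N ^ℚ 3 - D → + 8 / 1 * c ≤ 4ℚ * D →
  ½ * p ^ℚ 3 * (1ℚ - p) * N ^ℚ 4 - δ * N ^ℚ 4 < c → Z ≤ + 3 / 1 * δ * N ^ℚ 4
count⇒energy p N D Z c δ 0≤N 2≤δN Z≤ 8c≤4D many = ≤-by-difference
  (solve 6 (λ p N D Z c δ → con (+ 3 / 1) :* δ :* pow N 4 :- Z
     := pow p 3 :* (con 1ℚ :- p) :* pow N 4 :+ con 2ℚ :* pow N 3 :- D :- Z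
        :+ (con ¼ :* (con 4ℚ :* D :- con (+ 8 / 1) :* c)
        :+ (con 2ℚ :* (c :- (con ½ :* pow p 3 :* (con 1ℚ :- p) :* pow N 4 :- δ :* pow N 4))
        :+ pow N 3 :* (δ :* N :- con 2ℚ)))) refl p N D Z c δ)
  (+-nonneg (p≤q⇒0≤q-p Z≤) (+-nonneg (*-nonneg (from-yes (0ℚ ≤? ¼)) (p≤q⇒0≤q-p 8c≤4D))
    (+-nonneg (*-nonneg (from-yes (0ℚ ≤? 2ℚ)) (p≤q⇒0≤q-p (<⇒≤ many)))
              (*-nonneg (^-nonneg 0≤N 3) (p≤q⇒0≤q-p 2≤δN)))))

-- Both sides would agree without the δ term if S were pN². The correction -pN in S changes them by
-- O(N²), which δN³ ≥ 2N² absorbs.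
spread-bound : ∀ p N S V δ → S ≡ p * (N * N - N) → 0ℚ ≤ p → p ≤ 1ℚ → 2ℚ ≤ δ * N →
  V - 2ℚ * (p * N * S) + p * p * (N * N * N) ≤ V - ½ * (N * S) - (p * p - ½ * p) * N * (N * N) + δ * N ^ℚ 3
spread-bound p N _ V δ refl 0≤p p≤1 2≤δN = ≤-by-difference
  (solve 4 (λ p N V δ →
    let S = p :* (N :* N :- N)
    in V :- con ½ :* (N :* S) :- (p :* p :- con ½ :* p) :* N :* (N :* N) :+ δ :* pow N 3
         :- (V :- con 2ℚ :* (p :* N :* S) :+ p :* p :* (N :* N :* N))
       := N :* N :* (δ :* N :- con 2ℚ :+ (con 2ℚ :* ((con 1ℚ :- p) :* (con 1ℚ :+ p)) :+ con ½ :* p))) refl p N V δ)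
  (*-nonneg (square-nonneg N) (+-nonneg (p≤q⇒0≤q-p 2≤δN)
    (+-nonneg (*-nonneg (from-yes (0ℚ ≤? 2ℚ)) (*-nonneg (p≤q⇒0≤q-p p≤1) (+-nonneg (from-yes (0ℚ ≤? 1ℚ)) 0≤p)))
              (*-nonneg (from-yes (0ℚ ≤? ½)) 0≤p))))

square-mono-≤ : ∀ {p q} → 0ℚ ≤ p → p ≤ q → p * p ≤ q * q
square-mono-≤ 0≤p p≤q = *-mono-≤ 0≤p (≤-trans 0≤p p≤q) p≤q p≤q

-- The condition ε ≥ 4δ^(1/8) is expressed without roots, through 4⁸ = 65536.
module _ (δ ε : ℚ) (0<δ : 0ℚ < δ) (δ<10⁻⁶ : δ < + 1 / 1000000) (0≤ε : 0ℚ ≤ ε) (4⁸δ≤ε⁸ : + 65536 / 1 * δ ≤ ε ^ℚ 8) where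

  private
    r : ℚ
    r = ε * ε

    0≤r : 0ℚ ≤ r
    0≤r = square-nonneg ε

    -- Since ε⁸ = r⁴, the contrary would give 65536 ≤ 16.
    r⁴≰16δ : ¬ (r * r * (r * r) ≤ + 16 / 1 * δ)
    r⁴≰16δ r⁴≤16δ = from-no (+ 65536 / 1 ≤? + 16 / 1) (*-cancelʳ-≤-pos δ {{positive 0<δ}} (begin
      + 65536 / 1 * δ        ≤⟨ 4⁸δ≤ε⁸ ⟩
      ε ^ℚ 8                 ≡⟨ solve 1 (λ e → pow e 8 := e :* e :* (e :* e) :* (e :* e :* (e :* e))) refl ε ⟩
      r * r * (r * r)        ≤⟨ r⁴≤16δ ⟩
      + 16 / 1 * δ           ∎))
      where open ≤-Reasoning

    16δ≤1 : + 16 / 1 * δ ≤ 1ℚ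
    16δ≤1 = ≤-trans (*-monoˡ-≤ (from-yes (0ℚ ≤? + 16 / 1)) (<⇒≤ δ<10⁻⁶)) (from-yes (+ 16 / 1 * (+ 1 / 1000000) ≤? 1ℚ))

    -- The smallness of `δ` enters here: as 16δ ≤ 1, r² ≤ 16δ squares to r⁴ ≤ 16δ.
    r²≰16δ : ¬ (r * r ≤ + 16 / 1 * δ)
    r²≰16δ r²≤16δ = r⁴≰16δ (subst (r * r * (r * r) ≤_) (*-identityʳ _)
      (*-mono-≤ (square-nonneg r) (from-yes (0ℚ ≤? 1ℚ)) r²≤16δ (≤-trans r²≤16δ 16δ≤1)))

    r≰16δ : ¬ (r ≤ + 16 / 1 * δ)
    r≰16δ r≤16δ = r²≰16δ (subst (r * r ≤_) (*-identityʳ _)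
      (*-mono-≤ 0≤r (from-yes (0ℚ ≤? 1ℚ)) r≤16δ (≤-trans r≤16δ 16δ≤1)))

  -- X, Z, T stand for Σ|c − p²N|, the sum of squared residuals and the sum of residuals, v for the degree variance.
  deviation-bound : ∀ N X Z T v → 0ℚ < N → Z ≤ + 3 / 1 * δ * N ^ℚ 4 → v ≤ T + δ * N ^ℚ 3 →
    T * T ≤ N * N * Z → X * X ≤ N * N * (2ℚ * Z + ½ * (N * v)) → X < ε * N ^ℚ 3
  -- By contradiction: X ≥ εN³ forces T ≥ rN³, and then r²N⁶ ≤ T² ≤ N²Z ≤ 3δN⁶.
  deviation-bound N X Z T v 0<N Z≤ v≤ T²≤ X²≤ = ≰⇒> λ εN³≤X → r²≰16δ (r²≤16δ εN³≤X)
    where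
    open ≤-Reasoning
    0≤N = <⇒≤ 0<N
    0<N³ = ^-pos 0<N 3
    0≤N³ = <⇒≤ 0<N³

    -- From rN³ ≤ 7δN³ + ½T follows T ≥ 2rN³ - 14δN³, and r > 16δ lets one rN³ absorb the δ term.
    εN³≤X⇒rN³≤T : ε * N ^ℚ 3 ≤ X → r * N ^ℚ 3 ≤ T
    εN³≤X⇒rN³≤T εN³≤X = ≤-by-difference
      (solve 4 (λ r δ m t → t :- r :* m := con 2ℚ :* (con (+ 7 / 1) :* (δ :* m) :+ con ½ :* t :- r :* m)
                   :+ (m :* (r :- con (+ 16 / 1) :* δ) :+ con 2ℚ :* (δ :* m))) refl r δ (N ^ℚ 3) T)
      (+-nonneg (*-nonneg (from-yes (0ℚ ≤? 2ℚ)) (p≤q⇒0≤q-p rN³≤))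
        (+-nonneg (*-nonneg 0≤N³ (p≤q⇒0≤q-p (<⇒≤ (≰⇒> r≰16δ)))) (*-nonneg (from-yes (0ℚ ≤? 2ℚ)) (*-nonneg (<⇒≤ 0<δ) 0≤N³))))
      where
      -- 2Z contributes 6δN⁴ and ½Nv contributes ½NT + ½δN⁴; the total 6½ is rounded up to 7.
      rN³≤ : r * N ^ℚ 3 ≤ + 7 / 1 * (δ * N ^ℚ 3) + ½ * T
      rN³≤ = *-cancelˡ-≤ 0<N³ (begin
        N ^ℚ 3 * (r * N ^ℚ 3)                            ≡⟨ solve 2 (λ e m → m :* (e :* e :* m) := e :* m :* (e :* m)) refl ε (N ^ℚ 3) ⟩
        ε * N ^ℚ 3 * (ε * N ^ℚ 3)                        ≤⟨ square-mono-≤ (*-nonneg 0≤ε 0≤N³) εN³≤X ⟩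
        X * X                                            ≤⟨ X²≤ ⟩
        N * N * (2ℚ * Z + ½ * (N * v))                   ≤⟨ ≤-by-difference
          (solve 5 (λ N δ Z T v → pow N 3 :* (con (+ 7 / 1) :* (δ :* pow N 3) :+ con ½ :* T) :- N :* N :* (con 2ℚ :* Z :+ con ½ :* (N :* v))
             := con 2ℚ :* (N :* N :* (con (+ 3 / 1) :* δ :* pow N 4 :- Z)) :+ (con ½ :* (pow N 3 :* (T :+ δ :* pow N 3 :- v))
                :+ con ½ :* (δ :* (pow N 3 :* pow N 3)))) refl N δ Z T v)
          (+-nonneg (*-nonneg (from-yes (0ℚ ≤? 2ℚ)) (*-nonneg (square-nonneg N) (p≤q⇒0≤q-p Z≤)))
            (+-nonneg (*-nonneg (from-yes (0ℚ ≤? ½)) (*-nonneg 0≤N³ (p≤q⇒0≤q-p v≤)))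
              (*-nonneg (from-yes (0ℚ ≤? ½)) (*-nonneg (<⇒≤ 0<δ) (square-nonneg (N ^ℚ 3)))))) ⟩
        N ^ℚ 3 * (+ 7 / 1 * (δ * N ^ℚ 3) + ½ * T)        ∎)

    r²≤16δ : ε * N ^ℚ 3 ≤ X → r * r ≤ + 16 / 1 * δ
    r²≤16δ εN³≤X = ≤-trans (*-cancelˡ-≤ (*-pos 0<N³ 0<N³) (begin
      N ^ℚ 3 * N ^ℚ 3 * (r * r)                  ≡⟨ solve 2 (λ r m → m :* m :* (r :* r) := r :* m :* (r :* m)) refl r (N ^ℚ 3) ⟩
      r * N ^ℚ 3 * (r * N ^ℚ 3)                  ≤⟨ square-mono-≤ (*-nonneg 0≤r 0≤N³) (εN³≤X⇒rN³≤T εN³≤X) ⟩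
      T * T                                      ≤⟨ T²≤ ⟩
      N * N * Z                                  ≤⟨ *-monoˡ-≤ (square-nonneg N) Z≤ ⟩
      N * N * (+ 3 / 1 * δ * N ^ℚ 4)             ≡⟨ solve 2 (λ N δ → N :* N :* (con (+ 3 / 1) :* δ :* pow N 4) := pow N 3 :* pow N 3 :* (con (+ 3 / 1) :* δ)) refl N δ ⟩
      N ^ℚ 3 * N ^ℚ 3 * (+ 3 / 1 * δ)            ∎))
      (*-monoʳ-≤-nonNeg δ {{nonNegative (<⇒≤ 0<δ)}} (from-yes (+ 3 / 1 ≤? + 16 / 1)))

-- The product is the numerator, a positive integer. This Archimedean step makes the threshold n₀
-- explicit.
1≤p*↧p : ∀ p → 0ℚ < p → 1ℚ ≤ p * ℕ→ℚ (↧ₙ p)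
1≤p*↧p p@(mkℚ (ℤ.+[1+ m ]) d _) _ = toℚᵘ-cancel-≤ (begin
  ℚᵘ.mkℚᵘ (+ 1) 0                                        ≤⟨ ℚᵘ.*≤* (ℤ.+≤+ (ℕ.≤-trans (ℕ.≤-reflexive (ℕ.*-identityˡ (suc d ℕ.* 1))) (ℕ.*-monoˡ-≤ 1 (ℕ.m≤m+n (suc d) (m ℕ.* suc d))))) ⟩
  ℚᵘ.mkℚᵘ (ℤ.+[1+ m ]) d ℚᵘ.* ℚᵘ.mkℚᵘ (+ suc d) 0        ≃⟨ ℚᵘ.*-congˡ {toℚᵘ p} (toℚᵘ-ℕ→ℚ (suc d)) ⟨
  toℚᵘ p ℚᵘ.* toℚᵘ (ℕ→ℚ (suc d))                         ≃⟨ toℚᵘ-homo-* p (ℕ→ℚ (suc d)) ⟨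
  toℚᵘ (p * ℕ→ℚ (suc d))                                 ∎)
  where open ℚᵘ.≤-Reasoning
1≤p*↧p (mkℚ (+ 0) _ _) (*<* (ℤ.+<+ ()))
1≤p*↧p (mkℚ (ℤ.-[1+ _ ]) _ _) (*<* ())

-- The red graph

if-≤ : ∀ b {p q r} → p ≤ r → q ≤ r → (if b then p else q) ≤ r
if-≤ true  p≤r q≤r = p≤r
if-≤ false p≤r q≤r = q≤r

b2q : Bool → ℚ
b2q b = ℕ→ℚ (b2n b)

b2q-∧ : ∀ b c → b2q (b ∧ c) ≡ b2q b * b2q c
b2q-∧ true  c = sym (*-identityˡ (b2q c))
b2q-∧ false c = sym (*-zeroˡ (b2q c))

≠ᵇ-sym : ∀ {n} (x y : Fin n) → x ≠ᵇ y ≡ y ≠ᵇ x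
≠ᵇ-sym x y with x Fin.≟ y | y Fin.≟ x
... | yes _   | yes _   = refl
... | no _    | no _    = refl
... | yes x≡y | no y≢x  = contradiction (sym x≡y) y≢x
... | no x≢y  | yes y≡x = contradiction (sym y≡x) x≢y

isRRRB : Bool → Bool → Bool → Bool → Bool
isRRRB r₁ r₂ r₃ r₄ = does ((b2n r₁ ℕ.+ b2n r₂ ℕ.+ b2n r₃ ℕ.+ b2n r₄) ℕ.≟ 3)

-- If all six tests succeed the two sides coincide, and otherwise the left one is 0. Thus passing to
-- the loop-free red matrix can only add degenerate quadruples, which is harmless for an upper
-- bound.
isRRRB-distinct : ∀ ab ac ad bc bd cd r₁ r₂ r₃ r₄ →
  b2n (ab ∧ ac ∧ ad ∧ bc ∧ bd ∧ cd ∧ isRRRB r₁ r₂ r₃ r₄) ℕ.≤ b2n (isRRRB (ab ∧ r₁) (bc ∧ r₂) (cd ∧ r₃) (ad ∧ r₄))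
isRRRB-distinct true  true  true  true  true  true  _ _ _ _ = ℕ.≤-refl
isRRRB-distinct false _     _     _     _     _     _ _ _ _ = ℕ.z≤n
isRRRB-distinct true  false _     _     _     _     _ _ _ _ = ℕ.z≤n
isRRRB-distinct true  true  false _     _     _     _ _ _ _ = ℕ.z≤n
isRRRB-distinct true  true  true  false _     _     _ _ _ _ = ℕ.z≤n
isRRRB-distinct true  true  true  true  false _     _ _ _ _ = ℕ.z≤n
isRRRB-distinct true  true  true  true  true  false _ _ _ _ = ℕ.z≤n

∀-Bool? : {P : Bool → Set} → (∀ b → Dec (P b)) → Dec (∀ b → P b)
∀-Bool? P? = map′ (λ (t , f) → λ { true → t ; false → f }) (λ h → h true , h false) (P? true ×-dec P? false)

-- With three red edges exactly one triple product survives; with four, 4 - 4 = 0; with fewer, every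
-- product vanishes. The sixteen cases are settled by evaluation.
isRRRB-cyclic : ∀ r₁ r₂ r₃ r₄ → let p = b2q r₁; q = b2q r₂; r = b2q r₃; s = b2q r₄ in
  b2q (isRRRB r₁ r₂ r₃ r₄) ≤ 1ℚ * (p * q * r) + (1ℚ * (q * r * s) + (1ℚ * (r * s * p) + (1ℚ * (s * p * q) + (- 4ℚ * (p * q * r * s) + 0ℚ))))
isRRRB-cyclic = from-yes (∀-Bool? λ r₁ → ∀-Bool? λ r₂ → ∀-Bool? λ r₃ → ∀-Bool? λ r₄ →
  let p = b2q r₁; q = b2q r₂; r = b2q r₃; s = b2q r₄ in b2q (isRRRB r₁ r₂ r₃ r₄) ≤?
    1ℚ * (p * q * r) + (1ℚ * (q * r * s) + (1ℚ * (r * s * p) + (1ℚ * (s * p * q) + (- 4ℚ * (p * q * r * s) + 0ℚ)))))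

-- A record keeps both numbers as parameters for unification, so that nested sums are cast by
-- nesting `sumℕ↦sumℚ`.
record _↦_ (k : ℕ) (q : ℚ) : Set where
  constructor cast
  field ℕ→ℚ≡ : ℕ→ℚ k ≡ q

open _↦_

sumℕ↦sumℚ : ∀ n {f : Fin n → ℕ} {g : Fin n → ℚ} → (∀ i → f i ↦ g i) → sumℕ n f ↦ sumℚ n g
sumℕ↦sumℚ n {f} f↦g = cast (trans (ℕ→ℚ-sumℕ f) (L-cong (sumℚ-linear n) (λ i → ℕ→ℚ≡ (f↦g i))))

module RedGraph {n : ℕ} (G : RedBlueK n) where

  -- `colour` is arbitrary on the diagonal; clearing the diagonal gives a true adjacency matrix.
  red : Fin n → Fin n → Bool
  red x y = (x ≠ᵇ y) ∧ colour G x y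

  red-sym : ∀ x y → red x y ≡ red y x
  red-sym x y = cong₂ _∧_ (≠ᵇ-sym x y) (symm G x y)

  open Moments (λ x y → b2q (red x y)) (λ x y → cong b2q (red-sym x y)) public

  -- The conditions z ≠ x and z ≠ y in `codeg` are exactly the zero diagonal of `red`.
  codeg≡cod : ∀ x y → ℕ→ℚ (codeg G x y) ≡ cod x y
  codeg≡cod x y = ℕ→ℚ≡ {codeg G x y} {cod x y} (sumℕ↦sumℚ n (λ z → cast (trans
      (cong b2q (regroup (z ≠ᵇ x) (z ≠ᵇ y) (x ≠ᵇ z) (y ≠ᵇ z) (≠ᵇ-sym z x) (≠ᵇ-sym z y)))
      (b2q-∧ (red x z) (red y z)))))
    where
    regroup : ∀ p q p′ q′ {r s} → p ≡ p′ → q ≡ q′ → p ∧ q ∧ r ∧ s ≡ (p′ ∧ r) ∧ (q′ ∧ s)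
    regroup true  true  _ _         refl refl = refl
    regroup true  false _ _ {r}     refl refl = sym (∧-zeroʳ r)
    regroup false q     _ _         refl refl = refl

  upper : Fin n → Fin n → ℕ
  upper x y = b2n (does (toℕ x ℕ.<? toℕ y) ∧ colour G x y)

  -- By trichotomy an off-diagonal pair is counted in exactly one of its two orders, which makes `S`
  -- twice the number of red edges.
  red-split : ∀ x y → b2n (red x y) ≡ upper x y ℕ.+ upper y x
  red-split x y with ℕ.<-cmp (toℕ x) (toℕ y)
  ... | tri< x<y x≢y x≯y rewrite dec-false (x Fin.≟ y) (x≢y ∘ cong toℕ) | dec-true (toℕ x ℕ.<? toℕ y) x<y | dec-false (toℕ y ℕ.<? toℕ x) x≯y
        = sym (ℕ.+-identityʳ _)
  ... | tri≈ x≮y x≡y x≯y rewrite dec-true (x Fin.≟ y) (Fin.toℕ-injective x≡y) | dec-false (toℕ x ℕ.<? toℕ y) x≮y | dec-false (toℕ y ℕ.<? toℕ x) x≯y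
        = refl
  ... | tri> x≮y x≢y x>y rewrite dec-false (x Fin.≟ y) (x≢y ∘ cong toℕ) | dec-false (toℕ x ℕ.<? toℕ y) x≮y | dec-true (toℕ y ℕ.<? toℕ x) x>y
        = cong b2n (symm G x y)

  upperℚ : Fin n → Fin n → ℚ
  upperℚ x y = ℕ→ℚ (upper x y)

  pairs-upper : pairs n (λ (x , y) → upperℚ x y) ≡ ℕ→ℚ (redEdges G)
  pairs-upper = sym (ℕ→ℚ≡ {redEdges G} {pairs n (λ (x , y) → upperℚ x y)} (sumℕ↦sumℚ n (λ x → sumℕ↦sumℚ n (λ y → cast refl))))

  handshake : S ≡ 2ℚ * ℕ→ℚ (redEdges G)
  handshake = begin
    pairs n (λ (x , y) → b2q (red x y))                                          ≡⟨ L-cong Σₚ (λ (x , y) → trans (cong ℕ→ℚ (red-split x y)) (ℕ→ℚ-+ (upper x y) (upper y x))) ⟩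
    pairs n (λ (x , y) → upperℚ x y + upperℚ y x)                                  ≡⟨ L-+ Σₚ (λ (x , y) → upperℚ x y) (λ (x , y) → upperℚ y x) ⟩
    pairs n (λ (x , y) → upperℚ x y) + pairs n (λ (x , y) → upperℚ y x)            ≡⟨ +-congˡ (pairs n (λ (x , y) → upperℚ x y)) (pairs-swap upperℚ) ⟨
    pairs n (λ (x , y) → upperℚ x y) + pairs n (λ (x , y) → upperℚ x y)            ≡⟨ cong (λ e → e + e) pairs-upper ⟩
    ℕ→ℚ (redEdges G) + ℕ→ℚ (redEdges G)                                          ≡⟨ solve 1 (λ e → e :+ e := con 2ℚ :* e) refl (ℕ→ℚ (redEdges G)) ⟩
    2ℚ * ℕ→ℚ (redEdges G)                                                        ∎
    where open ≡-Reasoning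

  S≡ : ∀ p → HasRedDensity G p → S ≡ p * (N * N - N)
  S≡ p density = begin
    S                              ≡⟨ handshake ⟩
    2ℚ * ℕ→ℚ (redEdges G)          ≡⟨ cong (2ℚ *_) density ⟩
    2ℚ * (p * ℕ→ℚ (n C 2))         ≡⟨ solve 2 (λ p c → con 2ℚ :* (p :* c) := p :* (con 2ℚ :* c)) refl p (ℕ→ℚ (n C 2)) ⟩
    p * (2ℚ * ℕ→ℚ (n C 2))         ≡⟨ cong (p *_) (2*nC2 n) ⟩
    p * (N * N - N)                ∎
    where open ≡-Reasoning

  -- Counting RRRB-cycles

  distinctRRRB : Fin n → Fin n → Fin n → Fin n → ℕ
  distinctRRRB a b c d = b2n ((a ≠ᵇ b) ∧ (a ≠ᵇ c) ∧ (a ≠ᵇ d) ∧ (b ≠ᵇ c) ∧ (b ≠ᵇ d) ∧ (c ≠ᵇ d)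
    ∧ isRRRB (colour G a b) (colour G b c) (colour G c d) (colour G d a))

  distinctRRRB≤ : ∀ a b c d → distinctRRRB a b c d ℕ.≤ b2n (isRRRB (red a b) (red b c) (red c d) (red d a))
  -- The closing edge tests d ≠ a, while the six distinctness tests contain a ≠ d.
  distinctRRRB≤ a b c d rewrite ≠ᵇ-sym d a =
    isRRRB-distinct (a ≠ᵇ b) (a ≠ᵇ c) (a ≠ᵇ d) (b ≠ᵇ c) (b ≠ᵇ d) (c ≠ᵇ d) (colour G a b) (colour G b c) (colour G c d) (colour G d a)

  orderedRRRB≤ : ℕ→ℚ (orderedRRRB G) ≤ 4ℚ * (W - Q)
  orderedRRRB≤ = begin
    ℕ→ℚ (orderedRRRB G)
      ≡⟨ ℕ→ℚ≡ {orderedRRRB G} {quads n (λ (a , b , c , d) → ℕ→ℚ (distinctRRRB a b c d))}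
           (sumℕ↦sumℚ n λ a → sumℕ↦sumℚ n λ b → sumℕ↦sumℚ n λ c → sumℕ↦sumℚ n λ d → cast refl) ⟩
    quads n (λ (a , b , c , d) → ℕ→ℚ (distinctRRRB a b c d))
      ≤⟨ L-mono (quads-linear n) (λ (a , b , c , d) → ≤-trans (ℕ→ℚ-mono-≤ (distinctRRRB≤ a b c d))
           (isRRRB-cyclic (red a b) (red b c) (red c d) (red d a))) ⟩
    quads n (Positive-Linear.combination (quads-linear n) cyclic-terms)
      ≡⟨ quads-cyclic ⟩
    4ℚ * (W - Q) ∎
    where open ≤-Reasoning

  -- The division by 8 in `rrrbCycles` rounds down, the right direction for an upper bound.
  8*rrrbCycles≤ : + 8 / 1 * ℕ→ℚ (rrrbCycles G) ≤ 4ℚ * (W - Q)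
  8*rrrbCycles≤ = begin
    + 8 / 1 * ℕ→ℚ (rrrbCycles G)     ≡⟨ *-comm (+ 8 / 1) (ℕ→ℚ (rrrbCycles G)) ⟩
    ℕ→ℚ (rrrbCycles G) * ℕ→ℚ 8       ≡⟨ ℕ→ℚ-* (rrrbCycles G) 8 ⟨
    ℕ→ℚ (rrrbCycles G ℕ.* 8)         ≤⟨ ℕ→ℚ-mono-≤ (m/n*n≤m (orderedRRRB G) 8) ⟩
    ℕ→ℚ (orderedRRRB G)              ≤⟨ orderedRRRB≤ ⟩
    4ℚ * (W - Q)                     ∎
    where open ≤-Reasoning

  Z : ℚ → ℚ
  Z p = pairs n (λ (x , y) → residual k x y * residual k x y)
    where k = (p * p - ½ * p) * N

  Z-nonneg : ∀ p → 0ℚ ≤ Z p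
  Z-nonneg p = L-nonneg Σₚ (λ (x , y) → square-nonneg (residual ((p * p - ½ * p) * N) x y))

  spread-nonneg : ∀ p → 0ℚ ≤ spread p
  spread-nonneg p = L-nonneg Σᵥ (λ x → square-nonneg (deg x - p * N))

  module _ (p : ℚ) (0≤4p-1 : 0ℚ ≤ 4ℚ * p - 1ℚ) (2≤[4p-1]² : 2ℚ ≤ (4ℚ * p - 1ℚ) * (4ℚ * p - 1ℚ)) (p≤1 : p ≤ 1ℚ)
           (1≤n : 1 ℕ.≤ n) (density : HasRedDensity G p) where

    private
      1≤N : 1ℚ ≤ N
      1≤N = ℕ→ℚ-mono-≤ 1≤n

      0<N : 0ℚ < N
      0<N = <-≤-trans (from-yes (0ℚ <? 1ℚ)) 1≤N

      0≤p : 0ℚ ≤ p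
      0≤p = subst (0ℚ ≤_) (solve 1 (λ p → con ¼ :* (con 4ℚ :* p :- con 1ℚ :+ con 1ℚ) := p) refl p)
        (*-nonneg (from-yes (0ℚ ≤? ¼)) (+-nonneg 0≤4p-1 (from-yes (0ℚ ≤? 1ℚ))))

    Z≤ : Z p ≤ p ^ℚ 3 * (1ℚ - p) * N ^ℚ 4 + 2ℚ * N ^ℚ 3 - (W - Q)
    Z≤ = subst (_≤ p ^ℚ 3 * (1ℚ - p) * N ^ℚ 4 + 2ℚ * N ^ℚ 3 - (W - Q)) (sym (pairs-residual² _))
      (energy-bound p N S V W Q (S≡ p density) 0≤p p≤1 2≤[4p-1]² 1≤N (subst (0ℚ ≤_) (spread-expand p) (spread-nonneg p)))

    rrrbCycles≤ : ℕ→ℚ (rrrbCycles G) ≤ ½ * p ^ℚ 3 * (1ℚ - p) * N ^ℚ 4 + ℕ→ℚ 1 * N ^ℚ 3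
    rrrbCycles≤ = energy⇒count p N (W - Q) (Z p) (ℕ→ℚ (rrrbCycles G)) (Z-nonneg p) Z≤ 8*rrrbCycles≤

    quasirandom : ∀ δ ε → 0ℚ < δ → δ < + 1 / 1000000 → 0ℚ ≤ ε → + 65536 / 1 * δ ≤ ε ^ℚ 8 → 2ℚ ≤ δ * N →
      ½ * p ^ℚ 3 * (1ℚ - p) * N ^ℚ 4 - δ * N ^ℚ 4 < ℕ→ℚ (rrrbCycles G) → RedQuasirandom G p ε
    quasirandom δ ε 0<δ δ<10⁻⁶ 0≤ε 4⁸δ≤ε⁸ 2≤δN many =
      ≤-<-trans (L-mono Σₚ (λ (x , y) → off-diagonal x y))
        (deviation-bound δ ε 0<δ δ<10⁻⁶ 0≤ε 4⁸δ≤ε⁸ N X (Z p) T (spread p) 0<N Z≤3δN⁴ spread≤ T²≤ X²≤)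
      where
      k = (p * p - ½ * p) * N
      dev : Fin n → Fin n → ℚ
      dev x y = cod x y - p * p * N
      X = pairs n (λ (x , y) → ∣ dev x y ∣)
      T = pairs n (λ (x , y) → residual k x y)

      -- Quasirandomness sums over x ≠ y; including the diagonal only adds nonnegative terms.
      off-diagonal : ∀ x y → (if x ≠ᵇ y then ∣ ℕ→ℚ (codeg G x y) - p * p * ℕ→ℚ n ∣ else 0ℚ) ≤ ∣ dev x y ∣
      off-diagonal x y = if-≤ (x ≠ᵇ y) (≤-reflexive (cong (λ c → ∣ c - p * p * N ∣) (codeg≡cod x y))) (0≤∣p∣ (dev x y))

      Z≤3δN⁴ : Z p ≤ + 3 / 1 * δ * N ^ℚ 4
      Z≤3δN⁴ = count⇒energy p N (W - Q) (Z p) (ℕ→ℚ (rrrbCycles G)) δ (<⇒≤ 0<N) 2≤δN Z≤ 8*rrrbCycles≤ many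

      spread≤ : spread p ≤ T + δ * N ^ℚ 3
      spread≤ = subst₂ _≤_ (sym (spread-expand p)) (cong (_+ δ * N ^ℚ 3) (sym (pairs-residual k)))
        (spread-bound p N S V δ (S≡ p density) 0≤p p≤1 2≤δN)

      L1≡N² : pairs n (λ _ → 1ℚ) ≡ N * N
      L1≡N² = trans (pairs-const n 1ℚ) (*-identityʳ (N * N))

      pairs-cauchy-schwarz : ∀ f → pairs n f * pairs n f ≤ N * N * pairs n (λ i → f i * f i)
      pairs-cauchy-schwarz f = subst (λ m → pairs n f * pairs n f ≤ m * pairs n (λ i → f i * f i)) L1≡N²
        (cauchy-schwarz Σₚ (subst (0ℚ <_) (sym L1≡N²) (*-pos 0<N 0<N)) f)

      T²≤ : T * T ≤ N * N * Z p
      T²≤ = pairs-cauchy-schwarz (λ (x , y) → residual k x y)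

      -- Cauchy-Schwarz passes from absolute deviations to squares, where `codegree-variance`
      -- applies.
      X²≤ : X * X ≤ N * N * (2ℚ * Z p + ½ * (N * spread p))
      X²≤ = begin
        X * X                                                       ≤⟨ pairs-cauchy-schwarz (λ (x , y) → ∣ dev x y ∣) ⟩
        N * N * pairs n (λ (x , y) → ∣ dev x y ∣ * ∣ dev x y ∣)
          ≡⟨ cong (N * N *_) (L-cong Σₚ (λ (x , y) → sym (p*p≡∣p∣*∣p∣ (dev x y)))) ⟩
        N * N * pairs n (λ (x , y) → dev x y * dev x y)             ≤⟨ *-monoˡ-≤ (square-nonneg N) (codegree-variance p) ⟩
        N * N * (2ℚ * Z p + ½ * (N * spread p))                     ∎
        where open ≤-Reasoning

-- Roots are cleared: σ ≥ (1 + √2)/4 becomes 4σ - 1 ≥ 0 with (4σ - 1)² ≥ 2, and 4δ^(1/8) becomes any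
-- rational ε ≥ 0 with ε⁸ ≥ 4⁸δ.
theorem2p7 : (σ : ℚ) → 0ℚ ≤ (+ 4 / 1) * σ - 1ℚ → + 2 / 1 ≤ ((+ 4 / 1) * σ - 1ℚ) * ((+ 4 / 1) * σ - 1ℚ) → σ ≤ 1ℚ →
    (∃[ C ] ((n : ℕ) → n ≥ 1 → (G : RedBlueK n) → HasRedDensity G σ →
    ℕ→ℚ (rrrbCycles G) ≤ (+ 1 / 2) * (σ ^ℚ 3) * (1ℚ - σ) * (ℕ→ℚ n ^ℚ 4) + ℕ→ℚ C * (ℕ→ℚ n ^ℚ 3)))
    × ((δ : ℚ) → 0ℚ < δ → δ < + 1 / 1000000 →
    ∃[ n₀ ] ((n : ℕ) → n ≥ n₀ → (G : RedBlueK n) → HasRedDensity G σ →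
    (+ 1 / 2) * (σ ^ℚ 3) * (1ℚ - σ) * (ℕ→ℚ n ^ℚ 4) - δ * (ℕ→ℚ n ^ℚ 4) < ℕ→ℚ (rrrbCycles G) →
    (ε : ℚ) → 0ℚ ≤ ε → (+ 65536 / 1) * δ ≤ ε ^ℚ 8 → RedQuasirandom G σ ε))
theorem2p7 σ 0≤4σ-1 2≤[4σ-1]² σ≤1 =
  (1 , λ n n≥1 G density → RedGraph.rrrbCycles≤ G σ 0≤4σ-1 2≤[4σ-1]² σ≤1 n≥1 density) ,
  -- Taking n₀ as twice the denominator of `δ` ensures δn ≥ 2, which absorbs the lower-order errors;
  -- as n₀ is positive, n ≥ 1 follows too.
  λ δ 0<δ δ<10⁻⁶ → 2 ℕ.* ↧ₙ δ , λ n n≥n₀ G density many ε 0≤ε 4⁸δ≤ε⁸ →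
    RedGraph.quasirandom G σ 0≤4σ-1 2≤[4σ-1]² σ≤1 (ℕ.≤-trans (ℕ.s≤s ℕ.z≤n) n≥n₀) density δ ε 0<δ δ<10⁻⁶ 0≤ε 4⁸δ≤ε⁸ (2≤δn δ 0<δ n≥n₀) many
  where
  2≤δn : ∀ δ {n} → 0ℚ < δ → n ≥ 2 ℕ.* ↧ₙ δ → 2ℚ ≤ δ * ℕ→ℚ n
  2≤δn δ {n} 0<δ n≥n₀ = begin
    2ℚ * 1ℚ                       ≤⟨ *-monoˡ-≤ (from-yes (0ℚ ≤? 2ℚ)) (1≤p*↧p δ 0<δ) ⟩
    2ℚ * (δ * ℕ→ℚ (↧ₙ δ))         ≡⟨ solve 2 (λ δ d → con 2ℚ :* (δ :* d) := δ :* (con 2ℚ :* d)) refl δ (ℕ→ℚ (↧ₙ δ)) ⟩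
    δ * (2ℚ * ℕ→ℚ (↧ₙ δ))         ≡⟨ cong (δ *_) (ℕ→ℚ-* 2 (↧ₙ δ)) ⟨
    δ * ℕ→ℚ (2 ℕ.* ↧ₙ δ)          ≤⟨ *-monoˡ-≤ (<⇒≤ 0<δ) (ℕ→ℚ-mono-≤ n≥n₀) ⟩
    δ * ℕ→ℚ n                     ∎
    where open ≤-Reasoning
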